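{- Let $n$ be a positive integer and let $\lambda$ and $\mu$ be integer partitions of $n$. Then $\mathrm{pre}_2(\lambda) = \mathrm{pre}_2(\mu)$ if and only if $\lambda = \mu$.
   Context: An integer partition $\lambda = (\lambda_1, \dots, \lambda_\ell)$ of a positive integer $n$ is a weakly decreasing finite sequence of positive integers whose sum is $n$; the $\lambda_i$ are its parts and $\ell(\lambda)=\ell$ is its length. For a partition $\lambda = (\lambda_1,\dots,\lambda_\ell)$, $\mathrm{pre}_2(\lambda)$ denotes the partition whose multiset of parts is the multiset $\{\!\{\lambda_i\lambda_j : 1 \le i < j \le \ell\}\!\}$ (with multiplicities, arranged in weakly decreasing order); if $\ell < 2$ it is the empty partition. -}

module Defs where

open import Data.List.Base using (List; []; _∷_; _++_; map; sum)
open import Data.List.Relation.Binary.Permutation.Propositional using (↭-sym)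
open import Data.List.Relation.Binary.Permutation.Propositional.Properties using (All-resp-↭)
open import Data.List.Relation.Unary.All as All using (All; []; _∷_)
import Data.List.Relation.Unary.All.Properties as All
open import Data.List.Relation.Unary.Linked as Linked using (Linked)
open import Data.Nat.Base using (ℕ; _*_; _≥_; _>_)
open import Data.Nat.Properties using (≤-decTotalOrder; ≤-irrelevant; *-mono-≤)
import Relation.Binary.Construct.Flip.EqAndOrd as Flip
open import Relation.Binary.PropositionalEquality using (_≡_; refl)

open import Data.List.Sort (Flip.decTotalOrder ≤-decTotalOrder) using (sort; sort-↭; sort-↗)

record Partition : Set where
  constructor mkPartition
  field
    parts      : List ℕ
    decreasing : Linked _≥_ parts
    positive   : All (_> 0) parts

open Partition public

-- The proof fields are propositions, so _≡_ on partitions is equality of the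
-- sequences of parts.
parts-injective : ∀ {p q} → parts p ≡ parts q → p ≡ q
parts-injective {mkPartition _ d₁ p₁} {mkPartition _ d₂ p₂} refl
  with refl ← Linked.irrelevant ≤-irrelevant d₁ d₂
     | refl ← All.irrelevant ≤-irrelevant p₁ p₂ = refl

infix 4 _⊢_

-- p ⊢ n: p is a partition of n.
_⊢_ : Partition → ℕ → Set
p ⊢ n = sum (parts p) ≡ n

-- The products xᵢ * xⱼ over all positions i < j, with multiplicity.
pairProducts : List ℕ → List ℕ
pairProducts []       = []
pairProducts (x ∷ xs) = map (x *_) xs ++ pairProducts xs

pairProducts-positive : ∀ {xs} → All (_> 0) xs → All (_> 0) (pairProducts xs)
pairProducts-positive []         = []
pairProducts-positive (px ∷ pxs) =
  All.++⁺ (All.map⁺ (All.map (*-mono-≤ px) pxs)) (pairProducts-positive pxs)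

-- sort is taken with respect to _≥_, so its output is weakly decreasing.
pre₂ : Partition → Partition
pre₂ p = record
  { parts      = sort (pairProducts (parts p))
  ; decreasing = sort-↗ (pairProducts (parts p))
  ; positive   = All-resp-↭ (↭-sym (sort-↭ (pairProducts (parts p))))
                            (pairProducts-positive (positive p))
  }

{-# OPTIONS --safe #-}
-- Expanding a square, p_k(λ)² = p_2k(λ) + 2 p_k(pre₂ λ) for the power sums p_k,
-- so p_k and pre₂ determine p_2k.  Starting from p₁ = n, partitions of n with
-- equal pre₂ therefore agree in p_1, p_2, p_4, p_8, ….  For large exponents the
-- largest part dominates the power sum, hence agreement for unboundedly many
-- exponents forces the largest parts to agree; remove them and repeat.
module Submission where

open import Defs
open import Data.List.Base using (List; []; _∷_; _++_; map; length)
open import Data.List.Properties using (map-++; map-id; map-cong)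
open import Data.List.Relation.Binary.Permutation.Propositional using (_↭_; ↭-trans; ↭-sym; ↭-reflexive)
open import Data.List.Relation.Binary.Permutation.Propositional.Properties using (map⁺)
open import Data.List.Relation.Unary.All using (All; []; _∷_)
open import Data.List.Relation.Unary.Linked as Linked using (Linked)
open import Data.List.Relation.Unary.Linked.Properties using (Linked⇒All)
open import Data.Nat.Base
open import Data.Nat.ListAction using (sum)
open import Data.Nat.ListAction.Properties using (sum-++; sum-↭)
open import Data.Nat.Properties
open import Data.Nat.Tactic.RingSolver using (solve-∀)
open import Data.Product using (∃-syntax; _×_; _,_)
open import Function.Base using (flip)
open import Function.Bundles using (_⇔_; mk⇔)
import Relation.Binary.Construct.Flip.EqAndOrd as Flip
open import Relation.Binary.Definitions using (tri<; tri≈; tri>)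
open import Relation.Binary.PropositionalEquality
open import Relation.Nullary.Negation using (¬_; contradiction)

open import Data.List.Sort (Flip.decTotalOrder ≤-decTotalOrder) using (sort-↭)

^-distribʳ-* : ∀ m x y → (x * y) ^ m ≡ x ^ m * y ^ m
^-distribʳ-* zero    x y = refl
^-distribʳ-* (suc m) x y = begin
  x * y * (x * y) ^ m        ≡⟨ cong (x * y *_) (^-distribʳ-* m x y) ⟩
  x * y * (x ^ m * y ^ m)    ≡⟨ [m*n]*[o*p]≡[m*o]*[n*p] x y (x ^ m) (y ^ m) ⟩
  x * x ^ m * (y * y ^ m)    ∎
  where open ≡-Reasoning

n≤2^n : ∀ n → n ≤ 2 ^ n
n≤2^n zero    = z≤n
n≤2^n (suc n) = +-mono-≤ (m^n>0 2 n) (≤-trans (n≤2^n n) (m≤m+n (2 ^ n) 0))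

-- Bernoulli's inequality (1 + 1/b)^m ≥ 1 + m/b, multiplied by b^(m+1).
bernoulli : ∀ b m → (b + m) * b ^ m ≤ b * suc b ^ m
bernoulli b zero    = *-monoˡ-≤ 1 (≤-reflexive (+-identityʳ b))
bernoulli b (suc m) = begin
  -- The added slack is exactly what makes the left side factor, since `b * (b + suc m) + m` equals
  -- `suc b * (b + m)`.
  (b + suc m) * (b * b ^ m)      ≤⟨ m≤m+n _ (m * b ^ m) ⟩
  (b + suc m) * (b * b ^ m) + m * b ^ m
                                 ≡⟨ regroup b m (b ^ m) ⟩
  suc b * ((b + m) * b ^ m)      ≤⟨ *-monoʳ-≤ (suc b) (bernoulli b m) ⟩
  suc b * (b * suc b ^ m)        ≡⟨ swap b (suc b) (suc b ^ m) ⟩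
  b * (suc b * suc b ^ m)        ∎
  where
  open ≤-Reasoning
  regroup : ∀ b m t → (b + suc m) * (b * t) + m * t ≡ suc b * ((b + m) * t)
  regroup = solve-∀
  swap : ∀ b c t → c * (b * t) ≡ b * (c * t)
  swap = solve-∀

powerSum : ℕ → List ℕ → ℕ
powerSum m xs = sum (map (_^ m) xs)

powerSum-1 : ∀ xs → powerSum 1 xs ≡ sum xs
powerSum-1 xs = cong sum (trans (map-cong ^-identityʳ xs) (map-id xs))

powerSum-↭ : ∀ m {xs ys} → xs ↭ ys → powerSum m xs ≡ powerSum m ys
powerSum-↭ m xs↭ys = sum-↭ (map⁺ (_^ m) xs↭ys)

powerSum-scale : ∀ m x ys → powerSum m (map (x *_) ys) ≡ x ^ m * powerSum m ys
powerSum-scale m x []       = sym (*-zeroʳ (x ^ m))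
powerSum-scale m x (y ∷ ys) = begin
  (x * y) ^ m + powerSum m (map (x *_) ys)   ≡⟨ cong₂ _+_ (^-distribʳ-* m x y) (powerSum-scale m x ys) ⟩
  x ^ m * y ^ m + x ^ m * powerSum m ys      ≡⟨ *-distribˡ-+ (x ^ m) (y ^ m) _ ⟨
  x ^ m * (y ^ m + powerSum m ys)            ∎
  where open ≡-Reasoning

powerSum-pairProducts-∷ : ∀ m x xs → powerSum m (pairProducts (x ∷ xs)) ≡
                          x ^ m * powerSum m xs + powerSum m (pairProducts xs)
powerSum-pairProducts-∷ m x xs = begin
  powerSum m (pairProducts (x ∷ xs))
    ≡⟨ cong sum (map-++ (_^ m) (map (x *_) xs) (pairProducts xs)) ⟩
  sum (map (_^ m) (map (x *_) xs) ++ map (_^ m) (pairProducts xs))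
    ≡⟨ sum-++ (map (_^ m) (map (x *_) xs)) _ ⟩
  powerSum m (map (x *_) xs) + powerSum m (pairProducts xs)
    ≡⟨ cong (_+ powerSum m (pairProducts xs)) (powerSum-scale m x xs) ⟩
  x ^ m * powerSum m xs + powerSum m (pairProducts xs) ∎
  where open ≡-Reasoning

-- Induction on the list: in `(a + s) * (a + s)` the term `a * a` is the diagonal entry of the head,
-- and `2 * (a * s)` counts twice each product of the head with a later entry.
powerSum-square : ∀ m xs → powerSum m xs * powerSum m xs ≡
                  powerSum (2 * m) xs + 2 * powerSum m (pairProducts xs)
powerSum-square m []       = refl
powerSum-square m (x ∷ xs) = begin
  (a + s) * (a + s)                            ≡⟨ expand a s ⟩
  a * a + 2 * (a * s) + s * s                  ≡⟨ cong (a * a + 2 * (a * s) +_) (powerSum-square m xs) ⟩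
  a * a + 2 * (a * s) + (t + 2 * e)            ≡⟨ regroup (a * a) (a * s) t e ⟩
  (a * a + t) + 2 * (a * s + e)                ≡⟨ cong₂ (λ u v → u + t + 2 * v) x^2m (powerSum-pairProducts-∷ m x xs) ⟨
  (x ^ (2 * m) + t) + 2 * powerSum m (pairProducts (x ∷ xs)) ∎
  where
  open ≡-Reasoning
  a = x ^ m
  s = powerSum m xs
  t = powerSum (2 * m) xs
  e = powerSum m (pairProducts xs)
  expand : ∀ a s → (a + s) * (a + s) ≡ a * a + 2 * (a * s) + s * s
  expand = solve-∀
  regroup : ∀ u v t e → u + 2 * v + (t + 2 * e) ≡ (u + t) + 2 * (v + e)
  regroup = solve-∀
  x^2m : x ^ (2 * m) ≡ a * a
  x^2m = trans (cong (λ k → x ^ (m + k)) (+-identityʳ m)) (^-distribˡ-+-* x m m)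

-- Each step doubles the exponent: `powerSum-square` is applied to both lists, and the equal
-- contributions of the pair products cancel. The equal sums start the induction at exponent 1.
powerSum-2^k : ∀ xs ys → sum xs ≡ sum ys → pairProducts xs ↭ pairProducts ys →
               ∀ k → powerSum (2 ^ k) xs ≡ powerSum (2 ^ k) ys
powerSum-2^k xs ys Σ≡ _ zero = begin
  powerSum 1 xs   ≡⟨ powerSum-1 xs ⟩
  sum xs          ≡⟨ Σ≡ ⟩
  sum ys          ≡⟨ powerSum-1 ys ⟨
  powerSum 1 ys   ∎
  where open ≡-Reasoning
powerSum-2^k xs ys Σ≡ pp↭ (suc k) = +-cancelʳ-≡ (2 * e ys) _ _ (begin
  powerSum (2 * m) xs + 2 * e ys   ≡⟨ cong (λ v → powerSum (2 * m) xs + 2 * v) (powerSum-↭ m pp↭) ⟨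
  powerSum (2 * m) xs + 2 * e xs   ≡⟨ powerSum-square m xs ⟨
  powerSum m xs * powerSum m xs    ≡⟨ cong (λ v → v * v) (powerSum-2^k xs ys Σ≡ pp↭ k) ⟩
  powerSum m ys * powerSum m ys    ≡⟨ powerSum-square m ys ⟩
  powerSum (2 * m) ys + 2 * e ys   ∎)
  where
  open ≡-Reasoning
  m = 2 ^ k
  e : List ℕ → ℕ
  e zs = powerSum m (pairProducts zs)

powerSum-≤ : ∀ m {b xs} → All (_≤ b) xs → powerSum m xs ≤ length xs * b ^ m
powerSum-≤ m []           = z≤n
powerSum-≤ m (x≤b ∷ xs≤b) = +-mono-≤ (^-monoˡ-≤ m x≤b) (powerSum-≤ m xs≤b)

-- Since `a` is at least `suc b`, Bernoulli bounds the ratio of `a ^ m` to `b ^ m` below by 1 + m/b,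
-- which exceeds the number of entries once `m` reaches `b * length xs`. Both sides are multiplied
-- by `b` to stay within the naturals.
powerSum-dominated : ∀ m {a b xs} .{{_ : NonZero b}} → All (_≤ b) xs → b < a →
                     b * length xs ≤ m → powerSum m xs < a ^ m
powerSum-dominated m {a} {b} {xs} xs≤b b<a bℓ≤m = *-cancelˡ-< b _ _ (begin-strict
  b * powerSum m xs          ≤⟨ *-monoʳ-≤ b (powerSum-≤ m xs≤b) ⟩
  b * (length xs * b ^ m)    ≡⟨ *-assoc b (length xs) (b ^ m) ⟨
  b * length xs * b ^ m      <⟨ *-monoˡ-< (b ^ m) {{m^n≢0 b m}} (≤-<-trans bℓ≤m (m<n+m m (>-nonZero⁻¹ b))) ⟩
  (b + m) * b ^ m            ≤⟨ bernoulli b m ⟩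
  b * suc b ^ m              ≤⟨ *-monoʳ-≤ b (^-monoˡ-≤ m b<a) ⟩
  b * a ^ m                  ∎)
  where open ≤-Reasoning

-- Doubling reaches only powers of two, so agreement is asked at arbitrarily large exponents rather
-- than at all of them. This form survives removing a common head.
PowerSumsAgreeOften : List ℕ → List ℕ → Set
PowerSumsAgreeOften xs ys = ∀ N → ∃[ m ] N ≤ m × powerSum m xs ≡ powerSum m ys

PowerSumsAgreeOften-sym : ∀ xs ys → PowerSumsAgreeOften xs ys → PowerSumsAgreeOften ys xs
PowerSumsAgreeOften-sym xs ys agree N = let m , N≤m , eq = agree N in m , N≤m , sym eq

head-≮ : ∀ x xs y ys → Linked _≥_ (x ∷ xs) → x > 0 →
         PowerSumsAgreeOften (x ∷ xs) (y ∷ ys) → ¬ (x < y)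
head-≮ x xs y ys xs↘ x>0 agree x<y =
  -- The threshold of `powerSum-dominated` with bound `x`: beyond it, all of `x ∷ xs` together
  -- weighs less than `y ^ m` alone.
  let m , N≤m , eq = agree (x * length (x ∷ xs))
  in <⇒≱ (powerSum-dominated m {{>-nonZero x>0}} (Linked⇒All (flip ≤-trans) ≤-refl xs↘) x<y N≤m)
         (≤-trans (m≤m+n (y ^ m) (powerSum m ys)) (≤-reflexive (sym eq)))

-- A single exponent suffices: the empty sum is 0, while `y ^ m` is positive.
[]-¬agree : ∀ y ys → y > 0 → ¬ PowerSumsAgreeOften [] (y ∷ ys)
[]-¬agree y ys y>0 agree =
  let m , _ , eq = agree 0
  in <⇒≢ (≤-trans (m^n>0 y {{>-nonZero y>0}} m) (m≤m+n (y ^ m) (powerSum m ys))) eq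

powerSums-determine : ∀ xs ys → Linked _≥_ xs → All (_> 0) xs → Linked _≥_ ys → All (_> 0) ys →
                      PowerSumsAgreeOften xs ys → xs ≡ ys
powerSums-determine []       []       _ _         _ _         _     = refl
powerSums-determine []       (y ∷ ys) _ _         _ (y>0 ∷ _) agree = contradiction agree ([]-¬agree y ys y>0)
powerSums-determine (x ∷ xs) []       _ (x>0 ∷ _) _ _         agree =
  contradiction (PowerSumsAgreeOften-sym (x ∷ xs) [] agree) ([]-¬agree x xs x>0)
powerSums-determine (x ∷ xs) (y ∷ ys) xs↘ (x>0 ∷ xs>0) ys↘ (y>0 ∷ ys>0) agree with <-cmp x y
... | tri< x<y _ _ = contradiction x<y (head-≮ x xs y ys xs↘ x>0 agree)
... | tri> _ _ y<x = contradiction y<x (head-≮ y ys x xs ys↘ y>0 (PowerSumsAgreeOften-sym (x ∷ xs) (y ∷ ys) agree))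
... | tri≈ _ refl _ = cong (x ∷_)
  (powerSums-determine xs ys (Linked.tail xs↘) xs>0 (Linked.tail ys↘) ys>0
    -- Equal heads contribute the same `x ^ m` to both sides, so the tails agree at the same
    -- exponents.
    λ N → let m , N≤m , eq = agree N in m , N≤m , +-cancelˡ-≡ (x ^ m) _ _ eq)

-- Sorting only permutes, so both lists of products are permutations of one sorted list.
pre₂-≡⇒↭ : ∀ p q → pre₂ p ≡ pre₂ q → pairProducts (parts p) ↭ pairProducts (parts q)
pre₂-≡⇒↭ p q eq =
  ↭-trans (↭-sym (sort-↭ (pairProducts (parts p))))
          (↭-trans (↭-reflexive (cong parts eq)) (sort-↭ (pairProducts (parts q))))

theorem1 : (n : ℕ) → n > 0 → (p q : Partition) → p ⊢ n → q ⊢ n → (pre₂ p ≡ pre₂ q) ⇔ (p ≡ q)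
theorem1 n _ p q p⊢n q⊢n = mk⇔ pre₂-injective (cong pre₂)
  where
  pre₂-injective : pre₂ p ≡ pre₂ q → p ≡ q
  pre₂-injective eq = parts-injective
    (powerSums-determine (parts p) (parts q) (decreasing p) (positive p) (decreasing q) (positive q)
      -- The exponent `2 ^ N` is reached by `N` doublings and is at least `N`.
      λ N → 2 ^ N , n≤2^n N , powerSum-2^k (parts p) (parts q) (trans p⊢n (sym q⊢n)) (pre₂-≡⇒↭ p q eq) N)
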